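{- Let $\mathbb{N}=C_1\sqcup C_2$ be a partition of $\mathbb{N}$ into two disjoint sets. Then there exist $i\in\{1,2\}$ and an infinite set $B\subseteq\mathbb{N}$ such that $B+B\subseteq C_i$.
   Context: $\mathbb{N}=\{1,2,3,\ldots\}$. For $B\subseteq\mathbb{N}$, $B+B=\{x+y:x,y\in B\}$; the case $x=y$ is allowed. -}

module Defs where

open import Axiom.ExcludedMiddle using (ExcludedMiddle)
open import Data.Fin.Base using (Fin; zero; suc)
import Data.List.Membership.Propositional as List
open import Data.Nat.Base using (ℕ; _+_; _≤_)
open import Data.Product.Base using (_×_; ∃-syntax)
open import Level using (0ℓ; Setω)
open import Relation.Binary.PropositionalEquality.Core using (_≡_)
open import Relation.Nullary.Negation.Core using (¬_)
open import Relation.Unary using (Pred; _∈_; _⊆_; _≐_; _∪_; _⊥_)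

-- The theorem is one of classical mathematics.  Excluded middle is taken
-- as an explicit hypothesis, at every universe level, so that the
-- conclusion can be stated literally rather than in double-negated form.
Classical : Setω
Classical = ∀ {ℓ} → ExcludedMiddle ℓ

-- Sets of positive integers are represented as predicates on ℕ (which
-- contains 0) that are contained in ℕ⁺.
ℕ⁺ : Pred ℕ 0ℓ
ℕ⁺ n = 1 ≤ n

-- The parts are allowed to be empty.
IsPartition : (Fin 2 → Pred ℕ 0ℓ) → Set
IsPartition C = (ℕ⁺ ≐ C zero ∪ C (suc zero)) × (C zero ⊥ C (suc zero))

Finite : Pred ℕ 0ℓ → Set
Finite B = ∃[ xs ] (∀ {n} → n ∈ B → n List.∈ xs)

Infinite : Pred ℕ 0ℓ → Set
Infinite B = ¬ Finite B

infixl 6 _⊞_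

_⊞_ : Pred ℕ 0ℓ → Pred ℕ 0ℓ → Pred ℕ 0ℓ
(A ⊞ B) n = ∃[ x ] ∃[ y ] x ∈ A × y ∈ B × n ≡ x + y

module Submission where

-- Let c be a two-colouring of the naturals, with colours exchanged by not,
-- and put F n = c (n + n).  Call a relation Q on naturals unavoidable if every
-- infinite set contains x < y with Q x y.  If the theorem fails for c, then
-- for every i the relation
--
--     F (x + y + i) = not (F (x + x + i))                              (*)
--
-- is unavoidable, since otherwise the numbers x + x + i, for x in a suitable
-- infinite set, solve the problem (`rule`).  Unavoidable relations are closed
-- under finite intersections (`unavoidable-∩`, a form of Ramsey's theorem), so
-- (*) may be used for a whole window of offsets i at a time.
--
-- The contradiction comes from long blocks (`no-blocks`).  Let D be a partial
-- two-colouring of the naturals satisfying (*), where both sides may also be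
-- undefined, on windows of offsets.  Then D has no arbitrarily long blocks of
-- constant colour, arbitrarily far out.  Indeed, by (*), a block of colour κ and
-- sufficient length H at n forces the opposite colour at n + n, because
-- n + n′ lies in the block at n′ when n′ is much larger than n and its block
-- is long.  So long blocks of colour κ are doubled to long blocks of the
-- opposite colour, and there are numbers t at which a block of colour κ and
-- length 2H starts such that no such block starts at t + 1, ..., t + L, with
-- L arbitrarily large.  For two such numbers t and t′, with t′ and its L large
-- compared with t, there is a block of the opposite colour at t + t, so by (*)
-- one of colour κ at t + t′, where there should be none.
--
-- It remains to find such a D.  Take a uniformly recurrent sequence x in the
-- orbit closure of F (`recurrent`).  A Baire category argument
-- (`extend-to-good-pair`) gives a word a, occurring in x up to sign, such that
-- whenever y is a shift of x or the complement of one, y begins with a, and a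
-- occurs up to a sign σ in F at a large n, the value F (n + n) is the opposite
-- of σ xor y n.  Call the places where a or its complement occurs in F
-- markers.  If F, read from n on, agrees with x for a while, and n + p and n + q
-- are markers in that range, the value of F at twice either place can be read off the same entry
-- of x, so these two values agree (`same-value`).  Let D n be the common value
-- of F (m + m) over the markers m in a window of fixed length starting at n,
-- if there are any and they agree.  Then D has long constant blocks, because
-- markers have bounded gaps in x.  And D inherits (*) from F, because F (n + n)
-- satisfies (*) along with F (`rule₂`), and the definition of a marker is
-- unchanged when F is replaced by its complement.

open import Defs
open import Axiom.ExcludedMiddle using (ExcludedMiddle)
open import Data.Bool.Base using (Bool; true; false; not; _xor_)
open import Data.Bool.Properties
  using (¬-not; not-¬; not-involutive; not-distribˡ-xor)
open import Data.Empty using (⊥; ⊥-elim)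
open import Data.Fin.Base using (Fin; zero; suc)
open import Data.List.Base using (_∷_)
open import Data.List.Membership.Propositional using (_∈_)
open import Data.List.Relation.Unary.Any using (here; there)
open import Data.Nat.Base hiding (parity)
open import Data.Nat.ListAction using (sum)
open import Data.Nat.Properties
open import Data.Nat.Tactic.RingSolver using (solve-∀)
open import Data.Product.Base
  using (_×_; _,_; Σ; Σ-syntax; ∃; ∃-syntax; proj₁; proj₂)
open import Data.Sum.Base using (_⊎_; inj₁; inj₂)
open import Data.Unit.Base using (⊤; tt)
open import Level using (Level; 0ℓ)
open import Relation.Binary.Definitions using (tri<; tri≈; tri>)
open import Relation.Binary.PropositionalEquality
open import Relation.Nullary.Decidable.Core
  using (yes; no; does; decidable-stable)
open import Relation.Nullary.Negation.Core using (¬_)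
open import Relation.Unary using (Pred; _⊆_)

private variable
  a r : Level

-- Signs.  A sign is a Boolean σ acting by σ xor_, so that true exchanges the
-- two colours.

xor-involutive : ∀ σ b → σ xor (σ xor b) ≡ b
xor-involutive true  b = not-involutive b
xor-involutive false b = refl

xor-swap : ∀ σ τ b → σ xor (τ xor b) ≡ τ xor (σ xor b)
xor-swap true  true  b = refl
xor-swap true  false b = refl
xor-swap false true  b = refl
xor-swap false false b = refl

-- Unavoidable relations

-- The infinite sets of naturals, in the form used throughout.
Unbounded : Pred ℕ 0ℓ → Set
Unbounded S = ∀ n → ∃[ m ] n ≤ m × S m

-- Q x y holds for some x < y in every infinite set S.
Unavoidable : (ℕ → ℕ → Set) → Set₁
Unavoidable Q =
  ∀ (S : Pred ℕ 0ℓ) → Unbounded S → ∃[ x ] ∃[ y ] S x × S y × x < y × Q x y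

-- The main way to use unavoidability.  Iterating step gives a sequence of
-- states any two of which are related by the transitive relation R, and whose
-- values form an infinite set; so Q holds for the values of some two states.
module _ {Q : ℕ → ℕ → Set} (unav : Unavoidable Q)
         {A : Set a} (R : A → A → Set r) (val : A → ℕ)
         (R-trans : ∀ s t u → R s t → R t u → R s u)
         (R⇒< : ∀ {s t} → R s t → val s < val t)
         (step : ∀ s → Σ A (R s)) (start : A) where

  private
    state : ℕ → A
    state zero    = start
    state (suc n) = proj₁ (step (state n))

    R-suc : ∀ n → R (state n) (state (suc n))
    R-suc n = proj₂ (step (state n))

    R-mono′ : ∀ {i j} → i <′ j → R (state i) (state j)
    R-mono′ {i} (<′-base)  = R-suc i
    R-mono′ {i} (<′-step {j} p) = R-trans _ _ _ (R-mono′ p) (R-suc j)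

    R-mono : ∀ {i j} → i < j → R (state i) (state j)
    R-mono i<j = R-mono′ (<⇒<′ i<j)

    n≤val : ∀ n → n ≤ val (state n)
    n≤val zero    = z≤n
    n≤val (suc n) = ≤-<-trans (n≤val n) (R⇒< (R-suc n))

  chain : ∃[ s ] ∃[ t ] R s t × Q (val s) (val t)
  chain with unav (λ n → ∃[ i ] n ≡ val (state i))
                  (λ n → val (state n) , n≤val n , n , refl)
  ... | _ , _ , (i , refl) , (j , refl) , lt , q with <-cmp i j
  ... | tri< i<j _ _ = state i , state j , R-mono i<j , q
  ... | tri≈ _ refl _ = ⊥-elim (<-irrefl refl lt)
  ... | tri> _ _ j<i = ⊥-elim (<-asym lt (R⇒< (R-mono j<i)))

-- A special case.  W L n is read as: n is good to precision L.  If good numbers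
-- exist to every precision, some x < y are related by Q such that y is good to
-- a precision h x prescribed in terms of x, and x to precision 0.
diagonal :
  ∀ {Q : ℕ → ℕ → Set} → Unavoidable Q →
  (W : ℕ → ℕ → Set) →
  (∀ {L L′ n} → L ≤ L′ → W L′ n → W L n) →
  (∀ L → ∃[ n ] L ≤ n × W L n) →
  (h : ℕ → ℕ) →
  ∃[ x ] ∃[ y ] x < y × W 0 x × W (h x) y × Q x y
diagonal {Q} unav W anti pick h =
  finish (chain unav R val R-trans proj₁ step start)
  where
  A : Set
  A = ∃[ L ] ∃[ n ] W L n

  val : A → ℕ
  val (_ , n , _) = n

  R : A → A → Set
  R (L , n , _) (L′ , n′ , _) = n < n′ × h n ≤ L′ × L ≤ L′

  R-trans : ∀ s t u → R s t → R t u → R s u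
  R-trans _ _ _ (p , q , r) (p′ , q′ , r′) = <-trans p p′ , ≤-trans q r′ , ≤-trans r r′

  start : A
  start = let n , _ , w = pick 0 in 0 , n , w

  step : ∀ s → Σ A (R s)
  step (L , n , _) =
    let M = suc n + (h n + L)
        n′ , M≤n′ , w = pick M
    in (M , n′ , w)
     , ≤-trans (m≤m+n (suc n) (h n + L)) M≤n′
     , ≤-trans (m≤m+n (h n) L) (m≤n+m (h n + L) (suc n))
     , ≤-trans (m≤n+m L (h n)) (m≤n+m (h n + L) (suc n))

  finish : _ → _
  finish ((_ , x , wx) , (_ , y , wy) , (x<y , hx≤ , _) , q) =
    x , y , x<y , anti z≤n wx , anti hx≤ wy , q

unavoidable-map :
  ∀ {P Q : ℕ → ℕ → Set} → (∀ {x y} → P x y → Q x y) →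
  Unavoidable P → Unavoidable Q
unavoidable-map f u S inf =
  let x , y , sx , sy , x<y , p = u S inf in x , y , sx , sy , x<y , f p

trivial-unavoidable : Unavoidable (λ _ _ → ⊤)
trivial-unavoidable S inf =
  let x , _ , sx = inf 0
      y , x<y , sy = inf (suc x)
  in x , y , sx , sy , x<y , tt

halve : ∀ j → ∃[ q ] (j ≡ q + q ⊎ j ≡ suc (q + q))
halve zero = 0 , inj₁ refl
halve (suc j) with halve j
... | q , inj₁ e = q , inj₂ (cong suc e)
... | q , inj₂ e = suc q , inj₁ (cong suc (trans e (sym (+-suc q q))))

-- Consequences of excluded middle

module Classically (em : ExcludedMiddle 0ℓ) where

  by-contradiction : {A : Set} → (¬ A → ⊥) → A
  by-contradiction = decidable-stable em

  ¬∀⇒∃¬ : {A : Set} {P : A → Set} → ¬ (∀ x → P x) → ∃[ x ] ¬ P x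
  ¬∀⇒∃¬ h = by-contradiction λ none →
    h λ x → by-contradiction λ ¬px → none (x , ¬px)

  bounded : ∀ {S : Pred ℕ 0ℓ} → ¬ Unbounded S → ∃[ N ] ∀ m → N ≤ m → ¬ S m
  bounded h = let N , p = ¬∀⇒∃¬ h in N , λ m N≤m s → p (m , N≤m , s)

  -- One of the two colour classes of an infinite set is infinite.
  split : ∀ {S : Pred ℕ 0ℓ} → Unbounded S → (f : ℕ → Bool) →
          ∃[ κ ] Unbounded (λ n → S n × f n ≡ κ)
  split {S} inf f with em {P = Unbounded (λ n → S n × f n ≡ true)}
  ... | yes p = true , p
  ... | no ¬p = false , λ n →
    let N , none   = bounded ¬p
        m , le , s = inf (N + n)
    in m , ≤-trans (m≤n+m n N) le , s
         , ¬-not (λ eq → none m (≤-trans (m≤m+n N n) le) (s , eq))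

  -- Unavoidable relations are closed under intersection.  An infinite set T
  -- contains some x related by P to infinitely many members of T, for
  -- otherwise a subset of T on which P fails throughout can be chosen step by
  -- step.  Choosing such an x repeatedly, and passing to the members of T
  -- related to it, gives an infinite set on which P holds throughout, and Q
  -- holds for some two of its members.
  module _ {P Q : ℕ → ℕ → Set} (uP : Unavoidable P) (uQ : Unavoidable Q) where

    private
      -- The members of T above x that are related to x by P.
      Below : Pred ℕ 0ℓ → ℕ → Pred ℕ 0ℓ
      Below T x y = T y × x < y × P x y

      rich : ∀ (T : Pred ℕ 0ℓ) → Unbounded T → ∃[ x ] T x × Unbounded (Below T x)
      rich T inf = by-contradiction λ none →
        let module N = None none
            s , t , (lt , ge) , p =
              chain uP N.R proj₁ N.R-trans proj₁ N.step N.start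
        in proj₂ (N.bound s) (proj₁ t) ge (proj₂ t , lt , p)
        where
        module None (none : ¬ (∃[ x ] T x × Unbounded (Below T x))) where
          bound : (s : ∃ T) → ∃[ N ] ∀ m → N ≤ m → ¬ Below T (proj₁ s) m
          bound (x , tx) = bounded λ inf′ → none (x , tx , inf′)

          R : ∃ T → ∃ T → Set
          R s t = proj₁ s < proj₁ t × proj₁ (bound s) ≤ proj₁ t

          R-trans : ∀ s t u → R s t → R t u → R s u
          R-trans _ _ _ (p , q) (p′ , q′) = <-trans p p′ , ≤-trans q (<⇒≤ p′)

          step : ∀ s → Σ (∃ T) (R s)
          step s =
            let m , le , tm = inf (suc (proj₁ s) + proj₁ (bound s))
            in (m , tm) , ≤-trans (m≤m+n _ _) le
                        , ≤-trans (m≤n+m _ (suc (proj₁ s))) le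

          start : ∃ T
          start = let m , _ , tm = inf 0 in m , tm

    unavoidable-∩ : Unavoidable (λ x y → P x y × Q x y)
    unavoidable-∩ S inf =
      finish (chain uQ R val R-trans (λ (_ , lt , _) → lt) step start)
      where
      record State : Set₁ where
        field
          T   : Pred ℕ 0ℓ
          T⊆S : ∀ {n} → T n → S n
          val : ℕ
          val∈T : T val
          unb : Unbounded (Below T val)
      open State

      R : State → State → Set
      R s t = (∀ {n} → T t n → Below (T s) (val s) n)
            × val s < val t × P (val s) (val t)

      R-trans : ∀ s t u → R s t → R t u → R s u
      R-trans _ _ u (f , _) (g , _) =
        (λ z → f (proj₁ (g z))) , proj₂ (f (proj₁ (g (val∈T u))))

      start : State
      start = let x , sx , unb = rich S inf in
        record { T = S ; T⊆S = λ z → z ; val = x ; val∈T = sx ; unb = unb }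

      step : ∀ s → Σ State (R s)
      step s = let y , ty , unb′ = rich (Below (T s) (val s)) (unb s) in
        record { T = Below (T s) (val s) ; T⊆S = λ z → T⊆S s (proj₁ z)
               ; val = y ; val∈T = ty ; unb = unb′ }
        , (λ z → z) , proj₂ ty

      finish : _ → _
      finish (s , t , (_ , lt , p) , q) =
        val s , val t , T⊆S s (val∈T s) , T⊆S t (val∈T t) , lt , p , q

  -- Sequential compactness of the space of binary sequences.
  compactness : (u : ℕ → ℕ → Bool) →
    ∃[ x ] ∀ r → Unbounded (λ k → ∀ j → j < r → u k j ≡ x j)
  compactness u = x , λ l n →
    let k , le , s = proj₂ (stage l) n in k , le , agrees l s
    where
    stage : ℕ → Σ (Pred ℕ 0ℓ) Unbounded
    half : ∀ l → ∃[ κ ] Unbounded (λ k → proj₁ (stage l) k × u k l ≡ κ)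
    stage zero    = (λ _ → ⊤) , λ n → n , ≤-refl , tt
    stage (suc l) = _ , proj₂ (half l)
    half l = split (proj₂ (stage l)) (λ k → u k l)

    x : ℕ → Bool
    x l = proj₁ (half l)

    agrees : ∀ l {k} → proj₁ (stage l) k → ∀ j → j < l → u k j ≡ x j
    agrees (suc l) (s , e) j j<l with m≤n⇒m<n∨m≡n (≤-pred j<l)
    ... | inj₁ j<l′ = agrees l s j j<l′
    ... | inj₂ refl = e

  -- The last number with property E in an interval starting with one.
  last : ∀ {E : ℕ → Set} m d → E m →
         ∃[ t ] m ≤ t × t ≤ m + d × E t × (∀ s → t < s → s ≤ m + d → ¬ E s)
  last {E} m zero e = m , ≤-refl , m≤m+n m 0 , e , λ s m<s s≤ →
    ⊥-elim (<⇒≱ m<s (≤-trans s≤ (≤-reflexive (+-identityʳ m))))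
  last {E} m (suc d) e with em {P = E (m + suc d)}
  ... | yes e′ = m + suc d , m≤m+n m (suc d) , ≤-refl , e′ ,
    λ s <s s≤ → ⊥-elim (<⇒≱ <s s≤)
  ... | no ¬e′ =
    let t , m≤t , t≤ , et , none = last m d e in
    t , m≤t , ≤-trans t≤ (+-monoʳ-≤ m (n≤1+n d)) , et ,
    λ s t<s s≤ → case-last s t<s (m≤n⇒m<n∨m≡n s≤) none
    where
    case-last : ∀ {t} s → t < s → s < m + suc d ⊎ s ≡ m + suc d →
                (∀ s → t < s → s ≤ m + d → ¬ E s) → ¬ E s
    case-last s t<s (inj₁ s<) none =
      none s t<s (≤-pred (≤-trans s< (≤-reflexive (+-suc m d))))
    case-last s t<s (inj₂ refl) none = ¬e′

  -- A pigeonhole principle: κ can be chosen independently of L.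
  both : ∀ {P : Bool → ℕ → Set} → (∀ {κ L L′} → L ≤ L′ → P κ L′ → P κ L) →
         (∀ L → ∃[ κ ] P κ L) → ∃[ κ ] ∀ L → P κ L
  both {P} anti h with em {P = ∀ L → P true L}
  ... | yes p = true , p
  ... | no ¬p = false , λ L → other L (h (L₀ + L))
    where
    L₀ = proj₁ (¬∀⇒∃¬ ¬p)
    other : ∀ L → ∃[ κ ] P κ (L₀ + L) → P false L
    other L (true  , q) = ⊥-elim (proj₂ (¬∀⇒∃¬ ¬p) (anti (m≤m+n L₀ L) q))
    other L (false , q) = anti (m≤n+m L L₀) q

  -- Uniform recurrence

  -- The words of length r at place m of f and at place n of g are equal.
  Agree : (f : ℕ → Bool) (m : ℕ) (g : ℕ → Bool) (n r : ℕ) → Set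
  Agree f m g n r = ∀ j → j < r → f (m + j) ≡ g (n + j)

  -- The enumeration of all pairs of naturals by antidiagonals.
  next : ℕ × ℕ → ℕ × ℕ
  next (zero  , b) = suc b , 0
  next (suc a , b) = a , suc b

  enum : ℕ → ℕ × ℕ
  enum zero    = 0 , 0
  enum (suc k) = next (enum k)

  enum-surjective : ∀ a b → ∃[ k ] enum k ≡ (a , b)
  enum-surjective a b = along b a (axis (a + b))
    where
    Hit : ℕ → ℕ → Set
    Hit a b = ∃[ k ] enum k ≡ (a , b)

    along : ∀ b a → Hit (a + b) 0 → Hit a b
    along zero    a h = subst (λ z → Hit z 0) (+-identityʳ a) h
    along (suc b) a h =
      let k , e = along b (suc a) (subst (λ z → Hit z 0) (+-suc a b) h)
      in suc k , cong next e

    axis : ∀ d → Hit d 0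
    axis zero    = 0 , refl
    axis (suc d) = let k , e = along d 0 (axis d) in suc k , cong next e

  -- The orbit closure of F contains a uniformly recurrent sequence.  Going
  -- through all words of F one by one, a word is forbidden whenever
  -- arbitrarily long intervals, arbitrarily far out, avoid it together with
  -- all words forbidden before.  A limit of long intervals avoiding more and
  -- more forbidden words contains only words that could not be forbidden, and
  -- such a word occurs in all long intervals that avoid the words forbidden
  -- before it.
  module Recurrence (F : ℕ → Bool) where

    -- A n L is a property of the interval of length L starting at n.
    Thick : (ℕ → ℕ → Set) → Set
    Thick A = ∀ L → ∃[ n ] L ≤ n × A n L

    -- The k-th pair (m , r) stands for the word of length r at place m of F.
    -- Occ k n L: this word occurs within the interval of length L at n.
    Occ : ℕ → ℕ → ℕ → Set
    Occ k n L = ∃[ t ] t + proj₂ (enum k) ≤ L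
                     × Agree F (n + t) F (proj₁ (enum k)) (proj₂ (enum k))

    -- Av k n L: the interval avoids every forbidden word among the first k.
    -- Word k is forbidden if Forb k, avoiding it as well, is thick.
    Av : ℕ → ℕ → ℕ → Set
    Forb : ℕ → ℕ → ℕ → Set
    Av zero    n L = ⊤
    Av (suc k) n L = Av k n L × (Thick (Forb k) → ¬ Occ k n L)
    Forb k n L = Av k n L × ¬ Occ k n L

    Av-sub : ∀ k {n s L L′} → s + L′ ≤ L → Av k n L → Av k (n + s) L′
    Av-sub zero    le _ = tt
    Av-sub (suc k) {n} {s} le (av , f) = Av-sub k le av , λ th (t , t≤ , ag) →
      f th ( s + t
           , ≤-trans (≤-reflexive (+-assoc s t _)) (≤-trans (+-monoʳ-≤ s t≤) le)
           , λ j j< → trans (cong (λ z → F (z + j)) (sym (+-assoc n s t))) (ag j j<))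

    Av-antitone : ∀ {k l n L} → k ≤′ l → Av l n L → Av k n L
    Av-antitone (≤′-reflexive refl) av = av
    Av-antitone (≤′-step k≤l)  av = Av-antitone k≤l (proj₁ av)

    Av-thick : ∀ k → Thick (Av k)
    Av-thick zero    L = L , ≤-refl , tt
    Av-thick (suc k) with em {P = Thick (Forb k)}
    ... | yes th = λ L → let n , le , av , no-occ = th L in n , le , av , λ _ → no-occ
    ... | no ¬th = λ L → let n , le , av = Av-thick k L in n , le , av , λ th → ⊥-elim (¬th th)

    -- Every initial word of x occurs in F arbitrarily far out, and every word
    -- of x recurs in x with bounded gaps.
    recurrent :
      ∃[ x ] (∀ l N → ∃[ n ] N ≤ n × Agree F n x 0 l)
           × (∀ s r → ∃[ g ] ∀ u → ∃[ t ] t ≤ g × Agree x (u + t) x s r)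
    recurrent = x , occurs , uniform
      where
      pos : ℕ → ℕ
      pos k = proj₁ (Av-thick k k)

      k≤pos : ∀ k → k ≤ pos k
      k≤pos k = proj₁ (proj₂ (Av-thick k k))

      av : ∀ k → Av k (pos k) k
      av k = proj₂ (proj₂ (Av-thick k k))

      limit = compactness (λ k j → F (pos k + j))

      x : ℕ → Bool
      x = proj₁ limit

      near : ∀ l N → ∃[ k ] N ≤ k × (∀ j → j < l → F (pos k + j) ≡ x j)
      near = proj₂ limit

      occurs : ∀ l N → ∃[ n ] N ≤ n × Agree F n x 0 l
      occurs l N = let k , N≤k , ag = near l N in
        pos k , ≤-trans N≤k (k≤pos k) , ag

      shift : ∀ {m s l t r} → (∀ j → j < l → F (m + j) ≡ x j) → s + t + r ≤ l →
              Agree F (m + s + t) x (s + t) r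
      shift {m} {s} {l} {t} ag le j j<r =
        trans (cong F (trans (cong (_+ j) (+-assoc m s t)) (+-assoc m (s + t) j)))
              (ag (s + t + j) (≤-trans (+-monoʳ-< (s + t) j<r) le))

      uniform : ∀ s r → ∃[ g ] ∀ u → ∃[ t ] t ≤ g × Agree x (u + t) x s r
      uniform s r = g , λ u →
        let k , big , ag = near (u + g) (p + ((u + g) + g))
            p≤k  = ≤-trans (m≤m+n p _) big
            ug≤k = ≤-trans (m≤m+n (u + g) g) (≤-trans (m≤n+m _ p) big)
            g≤k  = ≤-trans (m≤n+m g (u + g)) (≤-trans (m≤n+m _ p) big)
            a    = Av-sub p {s = u} ug≤k (Av-antitone (≤⇒≤′ p≤k) (av k))
            t , t+r≤g , at = hits (pos k + u) (≤-trans g≤k (≤-trans (k≤pos k) (m≤m+n _ u))) a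
        in t , ≤-trans (m≤m+n t r) t+r≤g , λ j j<r →
             trans (sym (shift {s = u} {t = t} ag
                      (≤-trans (≤-reflexive (+-assoc u t r)) (+-monoʳ-≤ u t+r≤g)) j j<r))
                   (trans (at j j<r) (word j j<r))
        where
        w = near (s + r) 0

        m : ℕ
        m = pos (proj₁ w) + s

        word : ∀ j → j < r → F (m + j) ≡ x (s + j)
        word j j<r =
          trans (cong F (+-assoc (pos (proj₁ w)) s j))
                (proj₂ (proj₂ w) (s + j) (+-monoʳ-< s j<r))

        p : ℕ
        p = proj₁ (enum-surjective m r)

        enum-p : enum p ≡ (m , r)
        enum-p = proj₂ (enum-surjective m r)

        occ⁺ : ∀ {n L t} → t + r ≤ L → Agree F (n + t) F m r → Occ p n L
        occ⁺ {t = t} le ag rewrite enum-p = t , le , ag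

        occ⁻ : ∀ {n L} → Occ p n L → ∃[ t ] t + r ≤ L × Agree F (n + t) F m r
        occ⁻ o rewrite enum-p = o

        -- Word p is not forbidden, as it occurs in x.
        not-forb : ¬ Thick (Forb p)
        not-forb th =
          let k , big , ag = near (s + r) (suc p + (s + r))
              _ , f = Av-antitone (≤⇒≤′ (≤-trans (m≤m+n (suc p) (s + r)) big)) (av k)
          in f th (occ⁺ (≤-trans (m≤n+m (s + r) (suc p)) big)
                    (λ j j<r → trans (cong F (+-assoc (pos k) s j))
                       (trans (ag (s + j) (+-monoʳ-< s j<r)) (sym (word j j<r)))))

        found = ¬∀⇒∃¬ not-forb

        g : ℕ
        g = proj₁ found

        hits : ∀ n → g ≤ n → Av p n g → ∃[ t ] t + r ≤ g × Agree F (n + t) F m r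
        hits n g≤n a = occ⁻ (by-contradiction λ none → proj₂ found (n , g≤n , a , none))

  -- Blocks

  -- D κ n is read as: n has colour κ in a partial two-colouring D.
  module NoBlocks
    (D : Bool → ℕ → Set)
    (disjoint : ∀ {κ n} → D κ n → ¬ D (not κ) n)
    (flip : ∀ K → Unavoidable λ x y → ∀ i → i < K → ∀ κ →
              (D κ (x + y + i) → D (not κ) (x + x + i))
            × (D κ (x + x + i) → D (not κ) (x + y + i)))
    where

    Block : Bool → ℕ → ℕ → Set
    Block κ L n = ∀ j → j < L → D κ (n + j)

    -- Suppose that blocks of every length start at numbers n for which n + n + i
    -- does not have the opposite colour.  For two such numbers x < y, with the
    -- block at y long compared with x, the number x + y + i has colour κ.
    double : ∀ κ i → ∃[ H ] ∀ n → H ≤ n → Block κ H n → D (not κ) (n + n + i)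
    double κ i = by-contradiction λ none →
      let x , y , x<y , (_ , ¬d) , (b , _) , f =
            diagonal (flip (suc i)) W anti (pick none) (λ x → suc (x + i))
      in ¬d (proj₁ (f i ≤-refl κ)
              (subst (D κ) (trans (sym (+-assoc y x i)) (cong (_+ i) (+-comm y x)))
                     (b (x + i) ≤-refl)))
      where
      W : ℕ → ℕ → Set
      W L n = Block κ L n × ¬ D (not κ) (n + n + i)

      anti : ∀ {L L′ n} → L ≤ L′ → W L′ n → W L n
      anti le (b , ¬d) = (λ j j<L → b j (≤-trans j<L le)) , ¬d

      pick : ¬ (∃[ H ] ∀ n → H ≤ n → Block κ H n → D (not κ) (n + n + i)) →
             ∀ L → ∃[ n ] L ≤ n × W L n
      pick none L = by-contradiction λ none′ →
        none (L , λ n L≤n b → by-contradiction λ ¬d → none′ (n , L≤n , b , ¬d))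

    even-eq : ∀ n q → (n + q) + (n + q) + 0 ≡ n + n + (q + q)
    even-eq = solve-∀

    odd-eq : ∀ n q → (n + q) + (n + q) + 1 ≡ n + n + suc (q + q)
    odd-eq = solve-∀

    half-< : ∀ {q L} → q + q < L + L → q < L
    half-< lt = ≰⇒> λ L≤q → <⇒≱ lt (+-mono-≤ L≤q L≤q)

    Doubling : ℕ → Set
    Doubling H = ∀ κ {n i} → i < 2 → H ≤ n → Block κ H n → D (not κ) (n + n + i)

    doubling : ∃[ H ] 0 < H × Doubling H
    doubling = suc (h true + h false) , s≤s z≤n , λ κ {n} i<2 H≤n b →
      proj₂ (double κ _) n (≤-trans (bound κ i<2) H≤n)
            (λ j j< → b j (≤-trans j< (bound κ i<2)))
      where
      h : Bool → ℕ
      h κ = proj₁ (double κ 0) + proj₁ (double κ 1)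

      bound-h : ∀ κ {i} → i < 2 → proj₁ (double κ i) ≤ h κ
      bound-h κ {zero}        _ = m≤m+n _ _
      bound-h κ {suc zero}    _ = m≤n+m _ (proj₁ (double κ 0))
      bound-h κ {suc (suc i)} (s≤s (s≤s ()))

      bound : ∀ κ {i} → i < 2 → proj₁ (double κ i) ≤ suc (h true + h false)
      bound true  i<2 = ≤-trans (bound-h true i<2) (≤-trans (m≤m+n _ _) (n≤1+n _))
      bound false i<2 =
        ≤-trans (bound-h false i<2) (≤-trans (m≤n+m _ (h true)) (n≤1+n _))

    module Doubled (H : ℕ) (0<H : 0 < H) (double-H : Doubling H) where

      grow : ∀ κ {n L} → H ≤ n → Block κ (L + H) n → Block (not κ) (L + L) (n + n)
      grow κ {n} {L} H≤n b j j<
        with halve j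
      ... | q , inj₁ refl = subst (D (not κ)) (even-eq n q)
        (double-H κ (s≤s z≤n) (≤-trans H≤n (m≤m+n n q)) λ j j<H →
          subst (D κ) (sym (+-assoc n q j)) (b (q + j) (+-mono-< (half-< j<) j<H)))
      ... | q , inj₂ refl = subst (D (not κ)) (odd-eq n q)
        (double-H κ (s≤s (s≤s z≤n)) (≤-trans H≤n (m≤m+n n q)) λ j j<H →
          subst (D κ) (sym (+-assoc n q j))
                (b (q + j) (+-mono-< (half-< (≤-trans (n≤1+n _) j<)) j<H)))

      -- With x and y as t and t′, the block of length 2H at t is doubled to one
      -- of the same length; this is why the length 2H is used.
      no-blocks : ¬ (∀ L → ∃[ n ] L ≤ n × ∃[ κ ] Block κ L n)
      no-blocks blocks =
        let x , y , x<y , (H≤x , 0<x , ex , _) , (_ , _ , _ , none) , f =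
              diagonal (flip (H + H)) W anti pick (λ x → x)
            dx = grow κ {L = H} H≤x ex
        in none x 0<x ≤-refl λ j j< →
             subst (λ z → D z (y + x + j)) (not-involutive κ)
               (subst (λ z → D (not (not κ)) (z + j)) (+-comm x y)
                 (proj₂ (f j j< (not κ)) (dx j j<)))
        where
        P : Bool → ℕ → Set
        P κ L = ∃[ n ] L ≤ n × Block κ L n

        antiP : ∀ {κ L L′} → L ≤ L′ → P κ L′ → P κ L
        antiP le (n , L≤n , b) = n , ≤-trans le L≤n , λ j j< → b j (≤-trans j< le)

        fixed = both {P} antiP λ L → let n , le , κ , b = blocks L in κ , n , le , b

        κ : Bool
        κ = proj₁ fixed

        -- A block of colour κ starts here.
        E : ℕ → Set
        E = Block κ (H + H)

        W : ℕ → ℕ → Set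
        W L t = H ≤ t × 0 < t × E t × (∀ s → 0 < s → s ≤ L → ¬ E (t + s))

        anti : ∀ {L L′ n} → L ≤ L′ → W L′ n → W L n
        anti le (a , b , c , f) = a , b , c , λ s 0<s s≤ → f s 0<s (≤-trans s≤ le)

        -- Between a block of colour κ at m and a long block of the opposite
        -- colour at n + n, take the last t at which E holds.
        pick : ∀ L → ∃[ t ] L ≤ t × W L t
        pick L =
          let M = suc (L + H)
              m , le , b = proj₂ fixed (M + (H + H))
              n , le′ , b′ = proj₂ fixed (suc m + suc L + H)
              m≤n : m ≤ n
              m≤n = ≤-trans (≤-trans (n≤1+n m) (m≤m+n (suc m) (suc L + H)))
                      (≤-trans (≤-reflexive (sym (+-assoc (suc m) (suc L) H))) le′)
              H≤n = ≤-trans (m≤n+m H (suc m + suc L)) le′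
              opp = grow κ {L = suc m + suc L} H≤n b′
              M≤m = ≤-trans (m≤m+n M (H + H)) le
              d   = (n + n) ∸ m
              m+d : m + d ≡ n + n
              m+d = m+[n∸m]≡n (≤-trans m≤n (m≤m+n n n))
              t , m≤t , t≤ , et , after = last {E} m d
                (λ j j< → b j (≤-trans j< (m≤n+m (H + H) M)))
              M≤t = ≤-trans M≤m m≤t
          in t , ≤-trans (≤-trans (m≤m+n L H) (n≤1+n _)) M≤t
               , ≤-trans (≤-trans (m≤n+m H L) (n≤1+n _)) M≤t
               , ≤-trans (s≤s z≤n) M≤t
               , et
               , beyond L m n t opp (≤-trans t≤ (≤-reflexive m+d))
                   (λ s t<s s≤ → after s t<s (≤-trans s≤ (≤-reflexive (sym m+d))))
          where
          beyond : ∀ L m n t → Block (not κ) ((suc m + suc L) + (suc m + suc L)) (n + n) →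
                   t ≤ n + n → (∀ s → t < s → s ≤ n + n → ¬ E s) →
                   ∀ s → 0 < s → s ≤ L → ¬ E (t + s)
          beyond L m n t opp t≤ after s 0<s s≤L e with ≤-total (t + s) (n + n)
          ... | inj₁ le = after (t + s) (m<m+n t 0<s) le e
          ... | inj₂ ge =
            disjoint (subst (D κ) (+-identityʳ (t + s)) (e 0 (≤-trans 0<H (m≤m+n H H))))
              (subst (D (not κ)) (m+[n∸m]≡n ge) (opp j j<))
            where
            j = (t + s) ∸ (n + n)
            j≤L : j ≤ L
            j≤L = ≤-trans (m≤n+o⇒m∸n≤o _ (n + n) (+-monoˡ-≤ s t≤)) s≤L
            j< : j < (suc m + suc L) + (suc m + suc L)
            j< = ≤-trans (s≤s j≤L) (≤-trans (m≤n+m (suc L) (suc m)) (m≤m+n _ _))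

  -- The category argument

  -- y is a family of binary sequences.  The argument would produce, if no word
  -- were good, words w₁, w₂, ... of the family, each extending the preceding
  -- one, and numbers n₁ < n₂ < ..., such that w_k determines the value at n_k
  -- as F (n_k + n_k), and F contains w_k at all later n_l.  Then
  -- F (n_k + n_l) = F (n_k + n_k) for all k < l, against the rule.
  module Extension (F : ℕ → Bool)
    (rule : Unavoidable λ x y → F (x + y) ≡ not (F (x + x)))
    {I : Set} (y : I → ℕ → Bool) where

    -- The sequence y i′ begins with the first R entries of y i.
    Extends : I → ℕ → I → Set
    Extends i R i′ = ∀ j → j < R → y i′ j ≡ y i j

    -- The word a formed by the first R entries of y i is good: an occurrence of
    -- a in F at n determines F (n + n) from every member of the family beginning
    -- with a.
    Good : I → ℕ → Set
    Good i R = ∀ i′ → Extends i R i′ → ∀ n → R ≤ n →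
               (∀ j → j < R → F (n + j) ≡ y i j) → F (n + n) ≡ not (y i′ n)

    good-mono : ∀ i {R} i′ {R′} → R ≤ R′ → Extends i R i′ → Good i R → Good i′ R′
    good-mono _ _ R≤ ext good k extk n R′≤n ag =
      good k (λ j j< → trans (extk j (≤-trans j< R≤)) (ext j j<)) n (≤-trans R≤ R′≤n)
             (λ j j< → trans (ag j (≤-trans j< R≤)) (ext j j<))

    extend-to-good : ∀ i₀ R₀ → ∃[ i ] ∃[ R ] R₀ ≤ R × Extends i₀ R₀ i × Good i R
    extend-to-good i₀ R₀ = by-contradiction λ none →
      let module N = None none
          s , t , (_ , _ , ag) , q = chain rule N.R N.val N.R-trans
            (λ {s} {t} p → proj₁ (proj₂ p)) N.step N.start
      in N.clash {s} {t} ag q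
      where
      module None (none : ¬ (∃[ i ] ∃[ R ] R₀ ≤ R × Extends i₀ R₀ i × Good i R)) where

        -- A state holds the word of length n + 1 of y i, with y i n = F (n + n).
        A : Set
        A = ∃[ i ] ∃[ n ] R₀ ≤ suc n × Extends i₀ R₀ i × F (n + n) ≡ y i n

        val : A → ℕ
        val (_ , n , _) = n

        R : A → A → Set
        R (i , n , _) (i′ , n′ , _) =
          Extends i (suc n) i′ × n < n′ × (∀ j → j < suc n → F (n′ + j) ≡ y i j)

        R-trans : ∀ s t u → R s t → R t u → R s u
        R-trans _ _ _ (e , lt , _) (e′ , lt′ , ag) =
            (λ j j< → trans (e′ j (<-trans j< (s≤s lt))) (e j j<))
          , <-trans lt lt′
          , λ j j< → trans (ag j (<-trans j< (s≤s lt))) (e j j<)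

        clash : ∀ {s t} → (∀ j → j < suc (val s) → F (val t + j) ≡ y (proj₁ s) j) →
                F (val s + val t) ≢ not (F (val s + val s))
        clash {_ , n , _ , _ , e} {_ , n′ , _} ag q =
          not-¬ (trans (trans (cong F (+-comm n n′)) (ag n ≤-refl)) (sym e)) q

        -- Failure of goodness at each extension of the initial word.
        bad : ∀ i R → R₀ ≤ R → Extends i₀ R₀ i →
              ∃[ i′ ] ∃[ n ] Extends i R i′ × R ≤ n ×
                (∀ j → j < R → F (n + j) ≡ y i j) × F (n + n) ≡ y i′ n
        bad i R R₀≤ e = by-contradiction λ ¬bad → none (i , R , R₀≤ , e ,
          λ i′ e′ n R≤n ag → ¬-not λ eq → ¬bad (i′ , n , e′ , R≤n , ag , eq))

        start : A
        start =
          let i , n , e , le , _ , eq = bad i₀ R₀ ≤-refl (λ _ _ → refl)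
          in i , n , ≤-trans le (n≤1+n n) , e , eq

        step : ∀ s → Σ A (R s)
        step (i , n , R₀≤ , e , _) =
          let i′ , n′ , e′ , n<n′ , ag , eq = bad i (suc n) R₀≤ e
          in (i′ , n′ , ≤-trans R₀≤ (≤-trans n<n′ (n≤1+n n′))
                , (λ j j< → trans (e′ j (≤-trans j< R₀≤)) (e j j<)) , eq)
             , e′ , n<n′ , ag

    -- In a family closed under complements, a word and its complement can be
    -- made good together.
    module _ (neg : I → I) (y-neg : ∀ i j → y (neg i) j ≡ not (y i j)) where

      private
        neg-extends : ∀ i R i′ → Extends (neg i) R i′ → Extends i R (neg i′)
        neg-extends i R i′ e j j< =
          trans (y-neg i′ j)
            (trans (cong not (trans (e j j<) (y-neg i j))) (not-involutive _))

      extend-to-good-pair : I → ∃[ i ] ∃[ R ] Good i R × Good (neg i) R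
      extend-to-good-pair i₀ =
        let i₁ , R₁ , _ , _ , good₁ = extend-to-good i₀ 0
            k  , R , R₁≤R , e , good = extend-to-good (neg i₁) R₁
        in neg k , R
         , good-mono i₁ (neg k) R₁≤R (neg-extends i₁ R₁ k e) good₁
         , good-mono k (neg (neg k)) ≤-refl
             (neg-extends k R (neg k) (λ _ _ → refl)) good

  -- Markers

  -- c is assumed to be a counterexample, and a contradiction is derived.
  module Colouring (c : ℕ → Bool)
    (unsolvable : ∀ κ (B : Pred ℕ 0ℓ) → Unbounded B →
                  ¬ (∀ x y → B x → B y → c (x + y) ≡ κ)) where

    -- Since c is read at even numbers only, `rule` below holds for odd offsets i
    -- as well as for even ones.
    F : ℕ → Bool
    F n = c (n + n)

    rule : ∀ i → Unavoidable λ x y → F (x + y + i) ≡ not (F (x + x + i))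
    rule i S inf = by-contradiction λ none →
      let module N = None none
          κ , inf′ = split inf (λ x → F (x + x + i))
      in unsolvable κ (N.B κ) (N.unbounded inf′) N.mono
      where
      regroup : ∀ x y i → (x + x + i) + (y + y + i) ≡ (x + y + i) + (x + y + i)
      regroup = solve-∀

      module None (none : ¬ (∃[ x ] ∃[ y ] S x × S y × x < y
                               × F (x + y + i) ≡ not (F (x + x + i)))) where

        same : ∀ {x y} → S x → S y → x < y → F (x + y + i) ≡ F (x + x + i)
        same sx sy x<y =
          trans (¬-not λ eq → none (_ , _ , sx , sy , x<y , eq)) (not-involutive _)

        B : Bool → Pred ℕ 0ℓ
        B κ n = ∃[ x ] (S x × F (x + x + i) ≡ κ) × n ≡ x + x + i

        unbounded : ∀ {κ} → Unbounded (λ x → S x × F (x + x + i) ≡ κ) → Unbounded (B κ)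
        unbounded inf′ n =
          let x , n≤x , s = inf′ n
          in x + x + i
           , ≤-trans n≤x (≤-trans (m≤m+n x x) (m≤m+n (x + x) i)) , x , s , refl

        value : ∀ {κ x y} → S x × F (x + x + i) ≡ κ → S y × F (y + y + i) ≡ κ →
                F (x + y + i) ≡ κ
        value {x = x} {y} (sx , ex) (sy , ey) with <-cmp x y
        ... | tri< x<y _ _  = trans (same sx sy x<y) ex
        ... | tri≈ _ refl _ = ex
        ... | tri> _ _ y<x  =
          trans (cong (λ z → F (z + i)) (+-comm x y)) (trans (same sy sx y<x) ey)

        mono : ∀ {κ} m n → B κ m → B κ n → c (m + n) ≡ κ
        mono _ _ (x , sx , refl) (y , sy , refl) =
          trans (cong c (regroup x y i)) (value sx sy)

    F₂ : ℕ → Bool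
    F₂ n = F (n + n)

    rule₂ : ∀ i → Unavoidable λ x y → F₂ (x + y + i) ≡ not (F₂ (x + x + i))
    rule₂ i S inf =
      convert (rule (i + i) (λ n → ∃[ x ] S x × n ≡ x + x) λ n →
        let x , n≤x , s = inf n in x + x , ≤-trans n≤x (m≤m+n x x) , x , s , refl)
      where
      regroup : ∀ x y i → (x + x) + (y + y) + (i + i) ≡ (x + y + i) + (x + y + i)
      regroup = solve-∀

      convert : _ → _
      convert (_ , _ , (x , sx , refl) , (y , sy , refl) , lt , e) =
        x , y , sx , sy , ≰⇒> (λ y≤x → <⇒≱ lt (+-mono-≤ y≤x y≤x)) ,
        trans (cong F (sym (regroup x y i)))
              (trans e (cong (λ z → not (F z)) (regroup x x i)))

    -- F and F₂ take opposite values on the windows of length K at u and v.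
    record Opposite (K u v : ℕ) : Set where
      constructor opposite
      field at : ∀ j → j < K →
                 F (u + j) ≡ not (F (v + j)) × F₂ (u + j) ≡ not (F₂ (v + j))
    open Opposite

    opposite-sym : ∀ {K u v} → Opposite K u v → Opposite K v u
    opposite-sym o .at j j<K = let p , q = at o j j<K in swap p , swap q
      where
      swap : ∀ {a b} → a ≡ not b → b ≡ not a
      swap refl = sym (not-involutive _)

    opposite-≤ : ∀ {K L u v} → K ≤ L → Opposite L u v → Opposite K u v
    opposite-≤ K≤L o .at j j<K = at o j (≤-trans j<K K≤L)

    opposite-shift : ∀ {K u v} i → Opposite (i + K) u v → Opposite K (u + i) (v + i)
    opposite-shift {K} {u} {v} i o .at j j<K =
      let p , q = at o (i + j) (+-monoʳ-< i j<K) in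
        trans (cong F (+-assoc u i j))
              (trans p (cong (λ z → not (F z)) (sym (+-assoc v i j))))
      , trans (cong F₂ (+-assoc u i j))
              (trans q (cong (λ z → not (F₂ z)) (sym (+-assoc v i j))))

    opposite-rule : ∀ K → Unavoidable λ x y → Opposite K (x + y) (x + x)
    opposite-rule zero = unavoidable-map (λ _ → opposite λ _ ()) trivial-unavoidable
    opposite-rule (suc K) =
      unavoidable-map combine
        (unavoidable-∩ (opposite-rule K) (unavoidable-∩ (rule K) (rule₂ K)))
      where
      combine : ∀ {u v} → Opposite K u v × F (u + K) ≡ not (F (v + K))
                                         × F₂ (u + K) ≡ not (F₂ (v + K)) →
                Opposite (suc K) u v
      combine (o , p , q) .at j j< with m≤n⇒m<n∨m≡n (≤-pred j<)
      ... | inj₁ j<K  = at o j j<K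
      ... | inj₂ refl = p , q

    rule₀ : Unavoidable λ x y → F (x + y) ≡ not (F (x + x))
    rule₀ = unavoidable-map
      (λ {x} {y} e → trans (cong F (sym (+-identityʳ (x + y))))
        (trans e (cong (λ z → not (F z)) (+-identityʳ (x + x)))))
      (rule 0)

    -- x stands for a uniformly recurrent sequence in the orbit closure of F.
    module Markers
      (x : ℕ → Bool)
      (x-occurs : ∀ l N → ∃[ n ] N ≤ n × Agree F n x 0 l)
      (x-uniform : ∀ s r → ∃[ g ] ∀ u → ∃[ t ] t ≤ g × Agree x (u + t) x s r)
      where

      -- The shifts of x and their complements.
      y : ℕ × Bool → ℕ → Bool
      y (s , ε) j = ε xor x (s + j)

      neg : ℕ × Bool → ℕ × Bool
      neg (s , ε) = s , not ε

      y-neg : ∀ i j → y (neg i) j ≡ not (y i j)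
      y-neg (s , ε) j = sym (not-distribˡ-xor ε (x (s + j)))

      open Extension F rule₀ y

      -- A good word of length R, with sign ε, at place s of x.
      module Word (s : ℕ) (ε : Bool) (R : ℕ)
                  (good : Good (s , ε) R) (good-neg : Good (s , not ε) R) where

        word : ℕ → Bool
        word = y (s , ε)

        -- The word, with sign σ, occurs in F at n.
        Occurs : Bool → ℕ → Set
        Occurs σ n = ∀ j → j < R → F (n + j) ≡ σ xor word j

        -- An occurrence in F of the word or of its complement.
        Marker : ℕ → Set
        Marker n = ∃[ σ ] Occurs σ n

        -- Goodness of the word and of its complement in one formula.
        good-signed : ∀ i → Extends (s , ε) R i → ∀ σ n → R ≤ n → Occurs σ n →
                      F₂ n ≡ not (σ xor y i n)
        good-signed i e false n R≤n o = good i e n R≤n o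
        good-signed i e true  n R≤n o =
          trans (good-neg (neg i)
                   (λ j j< → trans (y-neg i j)
                     (trans (cong not (e j j<)) (sym (y-neg (s , ε) j))))
                   n R≤n (λ j j< → trans (o j j<) (sym (y-neg (s , ε) j))))
                (cong not (y-neg i n))

        swap-sum : ∀ p n q → p + (n + q) ≡ q + (n + p)
        swap-sum = solve-∀

        -- Goodness at n + p is used with the shift of x by q, and at n + q with
        -- the shift by p; both involve the entry n + p + q of x.
        same-value : ∀ {n l p q} → R ≤ n → Agree F n x 0 l →
                     p + R ≤ l → q + R ≤ l → Marker (n + p) → Marker (n + q) →
                     F₂ (n + p) ≡ F₂ (n + q)
        same-value {n} {l} {p} {q} R≤n ag p≤ q≤ (σ , op) (τ , oq) =
          trans (value p q q≤ σ op τ oq)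
                (trans (cong not (trans (xor-swap σ τ _)
                         (cong (λ z → τ xor (σ xor x z)) (swap-sum q n p))))
                       (sym (value q p p≤ τ oq σ op)))
          where
          value : ∀ p q → q + R ≤ l → ∀ σ → Occurs σ (n + p) → ∀ τ → Occurs τ (n + q) →
                  F₂ (n + p) ≡ not (σ xor (τ xor x (q + (n + p))))
          value p q q≤ σ op τ oq =
            good-signed (q , τ)
              (λ j j< → trans
                (cong (τ xor_) (trans
                  (sym (trans (cong F (+-assoc n q j))
                              (ag (q + j) (≤-trans (+-monoʳ-< q j<) q≤))))
                  (oq j j<)))
                (xor-involutive τ (word j)))
              σ (n + p) (≤-trans R≤n (m≤m+n n p)) op

        -- Every window of length g in x contains the start of an occurrence of
        -- the word.
        g : ℕ
        g = suc (proj₁ (x-uniform s R))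

        -- There are markers in the window of length g at n, and F₂ takes the value
        -- κ at all of them.
        D : Bool → ℕ → Set
        D κ n = (∃[ t ] t < g × Marker (n + t))
              × (∀ t → t < g → Marker (n + t) → F₂ (n + t) ≡ κ)

        D-disjoint : ∀ {κ n} → D κ n → ¬ D (not κ) n
        D-disjoint ((t , t<g , m) , f) (_ , f′) =
          not-¬ refl (trans (sym (f t t<g m)) (f′ t t<g m))

        marker-opposite : ∀ {u v} → Opposite (g + R) u v → ∀ t → t < g →
                          Marker (v + t) → Marker (u + t)
        marker-opposite {u} {v} o t t<g (σ , ov) = not σ , λ j j< →
          trans (cong F (+-assoc u t j))
            (trans (proj₁ (at o (t + j) (+-mono-< t<g j<)))
              (trans (cong not (trans (cong F (sym (+-assoc v t j))) (ov j j<)))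
                     (not-distribˡ-xor σ (word j))))

        D-opposite : ∀ {κ u v} → Opposite (g + R) u v → D κ v → D (not κ) u
        D-opposite {κ} {u} {v} o ((t , t<g , m) , f) =
            (t , t<g , marker-opposite o t t<g m)
          , λ t t<g m → trans (proj₂ (at o t (≤-trans t<g (m≤m+n g R))))
              (cong not (f t t<g
                (marker-opposite (opposite-sym o) t t<g m)))

        D-flip : ∀ K → Unavoidable λ x y → ∀ i → i < K → ∀ κ →
                   (D κ (x + y + i) → D (not κ) (x + x + i))
                 × (D κ (x + x + i) → D (not κ) (x + y + i))
        D-flip K = unavoidable-map
          (λ o i i<K κ →
            let o′ = opposite-shift i (opposite-≤ (+-monoˡ-≤ (g + R) (<⇒≤ i<K)) o)
            in D-opposite (opposite-sym o′) , D-opposite o′)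
          (opposite-rule (K + (g + R)))

        long-blocks : ∀ L → ∃[ n ] L ≤ n × ∃[ κ ] (∀ j → j < L → D κ (n + j))
        long-blocks L =
          let l = L + (g + R)
              n , big , ag = x-occurs l (L + R)
          in n , ≤-trans (m≤m+n L R) big
           , block n l ≤-refl (≤-trans (m≤n+m R L) big) ag
          where
          block : ∀ n l → L + (g + R) ≤ l → R ≤ n → Agree F n x 0 l →
                  ∃[ κ ] (∀ j → j < L → D κ (n + j))
          block n l le R≤n ag =
            F₂ (n + p₀) , λ j j<L →
              (let t , t<g , m = marker j (<⇒≤ j<L)
               in t , t<g , subst Marker (sym (+-assoc n j t)) m)
            , λ t t<g m → trans (cong F₂ (+-assoc n j t))
                (same-value R≤n ag (inside (<⇒≤ j<L) (<⇒≤ t<g)) (inside z≤n (<⇒≤ t₀<g))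
                   (subst Marker (+-assoc n j t) m) m₀)
            where
            inside : ∀ {j t} → j ≤ L → t ≤ g → j + t + R ≤ l
            inside {j} {t} j≤L t≤g = ≤-trans
              (≤-trans (≤-reflexive (+-assoc j t R)) (+-mono-≤ j≤L (+-monoˡ-≤ R t≤g))) le

            marker : ∀ j → j ≤ L → ∃[ t ] t < g × Marker (n + (j + t))
            marker j j≤L =
              let t , t≤ , at = proj₂ (x-uniform s R) j
              in t , s≤s t≤ , ε , λ k k<R →
                trans (cong F (+-assoc n (j + t) k))
                  (trans (ag (j + t + k)
                           (≤-trans (+-monoʳ-< (j + t) k<R) (inside j≤L (≤-trans t≤ (n≤1+n _)))))
                    (trans (at k k<R) (sym (xor-involutive ε (x (s + k))))))

            first = marker 0 z≤n
            p₀ = proj₁ first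
            t₀<g = proj₁ (proj₂ first)
            m₀ = proj₂ (proj₂ first)

        contradiction : ⊥
        contradiction = finish doubling
          where
          open NoBlocks D (λ {κ} {n} → D-disjoint {κ} {n}) D-flip
          finish : ∃[ H ] 0 < H × Doubling H → ⊥
          finish (H , 0<H , d) = Doubled.no-blocks H 0<H (λ κ → d κ) long-blocks

      contradiction : ⊥
      contradiction = finish (extend-to-good-pair neg y-neg (0 , false))
        where
        finish : ∃[ i ] ∃[ R ] Good i R × Good (neg i) R → ⊥
        finish ((s , ε) , R , good , good-neg) = Word.contradiction s ε R good good-neg

    contradiction : ⊥
    contradiction =
      let x , occurs , uniform = Recurrence.recurrent F
      in Markers.contradiction x occurs uniform

-- The theorem

x∈xs⇒x≤sum : ∀ {x xs} → x ∈ xs → x ≤ sum xs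
x∈xs⇒x≤sum {xs = y ∷ ys} (here refl) = m≤m+n y (sum ys)
x∈xs⇒x≤sum {xs = y ∷ ys} (there p)   = ≤-trans (x∈xs⇒x≤sum p) (m≤n+m (sum ys) y)

unbounded⇒infinite : ∀ {B} → Unbounded B → Infinite B
unbounded⇒infinite unb (xs , all) =
  let m , lt , b = unb (suc (sum xs)) in <⇒≱ lt (x∈xs⇒x≤sum (all b))

monochromatic :
  Classical → (c : ℕ → Bool) →
  ∃[ κ ] Σ[ B ∈ Pred ℕ 0ℓ ] Unbounded B × (∀ x y → B x → B y → c (x + y) ≡ κ)
monochromatic em c = decidable-stable em λ none →
  Classically.Colouring.contradiction em c λ κ B unb mono →
    none (κ , B , unb , mono)

theorem1p1 : Classical → (C : Fin 2 → Pred ℕ 0ℓ) → IsPartition C →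
    Σ[ i ∈ Fin 2 ] Σ[ B ∈ Pred ℕ 0ℓ ] (B ⊆ ℕ⁺ × Infinite B × B ⊞ B ⊆ C i)
theorem1p1 em C ((cover , _) , _) = conclude (monochromatic em c)
  where
  c : ℕ → Bool
  c n = does (em {P = C zero n})

  class : Bool → Fin 2
  class true  = zero
  class false = suc zero

  colour : ∀ κ {n} → 1 ≤ n → c n ≡ κ → C (class κ) n
  colour κ {n} 1≤n e with em {P = C zero n} | cover 1≤n
  colour true  1≤n e  | yes p | _      = p
  colour false 1≤n e  | no ¬p | inj₁ p = ⊥-elim (¬p p)
  colour false 1≤n e  | no ¬p | inj₂ p = p

  conclude :
    ∃[ κ ] Σ[ B ∈ Pred ℕ 0ℓ ] Unbounded B × (∀ x y → B x → B y → c (x + y) ≡ κ) →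
    Σ[ i ∈ Fin 2 ] Σ[ B ∈ Pred ℕ 0ℓ ] (B ⊆ ℕ⁺ × Infinite B × B ⊞ B ⊆ C i)
  conclude (κ , B , unb , mono) =
      class κ
    , (λ n → 1 ≤ n × B n)
    , proj₁
    , unbounded⇒infinite
        (λ n → let m , le , b = unb (suc n)
               in m , ≤-trans (n≤1+n n) le , ≤-trans (s≤s z≤n) le , b)
    , λ { (x , y , (1≤x , bx) , (_ , by) , refl) →
            colour κ (≤-trans 1≤x (m≤m+n x y)) (mono x y bx by) }
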